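{- Let $k\ge 3$ and $e\ge 3$. If there exists a strongly equitable $k$-chromatic $e$-star system of order $n_0\equiv 0\pmod{2e}$, then there exists, for some $n\equiv 0\pmod{2e}$, a strongly equitable uniquely $k$-chromatic $e$-star system of order $n$.
   Context: An $e$-star is the complete bipartite graph $K_{1,e}$. An $e$-star system of order $n$ is a pair $(V,\mathcal B)$ where $|V|=n$ and $\mathcal B$ is a set of $e$-stars (subgraphs of the complete graph $K_n$ on $V$) whose edge sets partition the edge set of $K_n$. An $e$-star system is $k$-colourable if $V$ can be partitioned into $k$ sets (colour classes) such that no star in $\mathcal B$ has all its vertices in the same class; it is $k$-chromatic if it is $k$-colourable but not $(k-1)$-colourable. It is uniquely $k$-colourable if any two $k$-colourings differ only by a permutation of the colours. A colouring is strongly equitable if all colour classes have the same size. A strongly equitable (uniquely) $k$-chromatic system is a (uniquely colourable) $k$-chromatic system admitting a strongly equitable $k$-colouring. -}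

module Defs where

open import Data.Nat using (ℕ)
open import Data.Fin using (Fin; _≟_)
open import Data.Fin.Permutation using (Permutation′; _⟨$⟩ʳ_)
open import Data.List using (length; filter; allFin)
open import Data.Product using (Σ; ∃; _×_; _,_)
open import Data.Sum using (_⊎_)
open import Relation.Nullary using (¬_)
open import Relation.Binary.PropositionalEquality using (_≡_; _≢_)

record Star (n e : ℕ) : Set where
  field
    centre : Fin n
    leaf   : Fin e → Fin n
    leaf≢centre : ∀ i → leaf i ≢ centre
open Star public

EdgeOf : ∀ {n e} → Star n e → Fin e → Fin n → Fin n → Set
EdgeOf s i u v = (centre s ≡ u × leaf s i ≡ v) ⊎ (centre s ≡ v × leaf s i ≡ u)

record StarSystem (n e : ℕ) : Set where
  field
    m     : ℕ
    block : Fin m → Star n e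
    partition : ∀ (u v : Fin n) → u ≢ v →
      Σ (Fin m) λ j → Σ (Fin e) λ i → EdgeOf (block j) i u v ×
        (∀ j′ i′ → EdgeOf (block j′) i′ u v → (j′ ≡ j × i′ ≡ i))
open StarSystem public

Colouring : ℕ → ℕ → Set
Colouring n k = Fin n → Fin k

Proper : ∀ {n e k} → StarSystem n e → Colouring n k → Set
Proper S c = ∀ j → ¬ (∀ i → c (leaf (block S j) i) ≡ c (centre (block S j)))

Colourable : ∀ {n e} → StarSystem n e → ℕ → Set
Colourable {n} S k = Σ (Colouring n k) λ c → Proper S c

Chromatic : ∀ {n e} → StarSystem n e → ℕ → Set
Chromatic S k = Colourable S k × ¬ Colourable S (Data.Nat.pred k)
  where import Data.Nat

UniquelyColourable : ∀ {n e} → StarSystem n e → ℕ → Set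
UniquelyColourable {n} S k = Colourable S k ×
  (∀ (c₁ c₂ : Colouring n k) → Proper S c₁ → Proper S c₂ →
     Σ (Permutation′ k) λ π → ∀ x → c₂ x ≡ π ⟨$⟩ʳ c₁ x)

classSize : ∀ {n k} → Colouring n k → Fin k → ℕ
classSize {n} c a = length (filter (λ x → c x ≟ a) (allFin n))

StronglyEquitable : ∀ {n k} → Colouring n k → Set
StronglyEquitable c = ∀ a b → classSize c a ≡ classSize c b

HasSEColouring : ∀ {n e} → StarSystem n e → ℕ → Set
HasSEColouring {n} S k = Σ (Colouring n k) λ c → Proper S c × StronglyEquitable c

SEChromatic : ∀ {n e} → StarSystem n e → ℕ → Set
SEChromatic S k = Chromatic S k × HasSEColouring S k

SEUniquelyChromatic : ∀ {n e} → StarSystem n e → ℕ → Set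
SEUniquelyChromatic S k = Chromatic S k × UniquelyColourable S k × HasSEColouring S k

-- Joining systems S and T (each vertex of S is the centre of stars whose leaf sets partition T) repeatedly, starting from
-- the given system, yields systems X consisting of t disjoint copies of it. In a proper k-colouring of X every colour occurs
-- in each copy, so all classes have at least t elements. Let c be the strongly equitable colouring of X.
--
-- For every colouring φ of X, one further copy is joined on top of X. If φ is not c up to a permutation, there are u and v
-- with φ u = φ v and c u ≠ c v, hence a leaf set that is φ-monochromatic of colour φ u and contains u and v. Choose
-- φ-monochromatic leaf sets for the other k - 1 colours; some colour d differs from the c-colours of a vertex from each
-- of them. Stars with these k leaf sets around a vertex y of colour d respect c, but leave no colour for y when X is
-- coloured by φ. Thus only the permutations of c extend, and c-monochromatic leaf sets of all colours other than that of y
-- force the colour of each new vertex y.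
module Submission where

open import Defs
open import Data.Nat using (ℕ; _≤_; _*_)
open import Data.Nat.Divisibility using (_∣_)
open import Data.Product using (Σ; _×_)

open import Data.Fin using (Fin; zero; suc; _≟_; _↑ˡ_; _↑ʳ_; splitAt; join; punchIn; punchOut; funToFin; finToFun)
open import Data.Fin.Permutation using (Permutation′; permutation; _⟨$⟩ʳ_; _⟨$⟩ˡ_; _∘ₚ_; flip; inverseˡ; inverseʳ)
open import Data.Fin.Properties using (+↔⊎; *↔×; any?; all?; ¬∀⟶∃¬; injective⇒≤; splitAt-↑ˡ; splitAt-↑ʳ; join-splitAt;
  punchIn-injective; punchInᵢ≢i; punchIn-punchOut; punchOut-injective; finToFun-funToFin; suc-injective)
open import Data.List using (List; []; _∷_; _++_; length; map; filter; concatMap; allFin; tabulate; lookup)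
open import Data.List.Membership.Propositional using (_∈_)
open import Data.List.Membership.Propositional.Properties using (∈-++⁺ˡ; ∈-++⁺ʳ; ∈-++⁻; ∈-∃++; ∈-allFin; ∈-lookup; ∈-tabulate⁺)
open import Data.List.Properties using (length-++; length-filter; length-tabulate; filter-++; ++-assoc; concatMap-++; map-tabulate)
open import Data.List.Relation.Binary.Disjoint.Propositional using (Disjoint)
open import Data.List.Relation.Binary.Permutation.Propositional using (_↭_; ↭-refl; ↭-reflexive; ↭-trans; ↭-sym; prep; ↭⇒↭ₛ)
open import Data.List.Relation.Binary.Permutation.Propositional.Properties using (shift; shifts; ++⁺ˡ; filter-↭; ↭-length; ∈-resp-↭)
import Data.List.Relation.Binary.Permutation.Setoid.Properties as PermutationSetoid
open import Data.List.Relation.Unary.All as All using (All; []; _∷_)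
import Data.List.Relation.Unary.All.Properties as All
open import Data.List.Relation.Unary.AllPairs using ([]; _∷_)
open import Data.List.Relation.Unary.Any using (here; there; index)
open import Data.List.Relation.Unary.Any.Properties using (lookup-index)
open import Data.List.Relation.Unary.Unique.Propositional using (Unique)
open import Data.List.Relation.Unary.Unique.Propositional.Properties using (allFin⁺)
open import Data.Nat using (zero; suc; _+_; _^_; _<_; z≤n; s≤s; _≤?_)
open import Data.Nat.Divisibility using (_∣0; n∣m*n; ∣-trans; ∣m∣n⇒∣m+n; ∣m+n∣m⇒∣n)
import Data.Nat.Properties as ℕ
open import Data.Nat.Properties hiding (_≟_; _≤?_; suc-injective)
open import Data.Nat.Tactic.RingSolver using (solve-∀)
open import Data.Product using (∃; ∃₂; _,_; proj₁; proj₂)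
open import Data.Product.Properties using (,-injectiveˡ; ,-injectiveʳ)
open import Data.Sum as Sum using (_⊎_; inj₁; inj₂; swap; [_,_]′)
open import Data.Sum.Function.Propositional using (_⊎-↔_)
open import Data.Sum.Properties using (inj₁-injective; inj₂-injective)
open import Data.Vec as Vec using (Vec; []; _∷_; toList; head)
open import Data.Vec.Properties using (length-toList)
open import Function using (_∘_; id; _↔_; Inverse; mk↔ₛ′)
open import Function.Construct.Composition using (_↔-∘_)
open import Function.Construct.Identity using (↔-id)
open import Relation.Binary.PropositionalEquality using (_≡_; _≢_; _≗_; refl; sym; trans; cong; cong₂; subst; setoid)
open import Relation.Nullary using (¬_; Dec; yes; no; ¬?; contradiction)
open import Relation.Nullary.Decidable using (_×-dec_; decidable-stable)
open import Relation.Unary using (Decidable)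

open Inverse using (to; from; strictlyInverseˡ; strictlyInverseʳ)

private variable
  A : Set
  e k l n r : ℕ

-- Joining two star systems.

module Join {n₁ n₂ e q : ℕ} (S : StarSystem n₁ e) (T : StarSystem n₂ e)
            (β : Fin n₁ → (Fin q × Fin e) ↔ Fin n₂) where

  private
    -- Vertices and blocks are kept as disjoint unions, so that cases are split by constructor; `σ`
    -- and `τ` transport the outcome to `Fin`.
    V J : Set
    V = Fin n₁ ⊎ Fin n₂
    J = Fin (m S) ⊎ Fin (m T) ⊎ (Fin n₁ × Fin q)

    hub : J → V
    hub (inj₁ j)              = inj₁ (centre (block S j))
    hub (inj₂ (inj₁ j))       = inj₂ (centre (block T j))
    hub (inj₂ (inj₂ (v , _))) = inj₁ v

    tip : J → Fin e → V
    tip (inj₁ j)              i = inj₁ (leaf (block S j) i)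
    tip (inj₂ (inj₁ j))       i = inj₂ (leaf (block T j) i)
    tip (inj₂ (inj₂ (v , j))) i = inj₂ (to (β v) (j , i))

    tip≢hub : ∀ j i → tip j i ≢ hub j
    tip≢hub (inj₁ j)        i = leaf≢centre (block S j) i ∘ inj₁-injective
    tip≢hub (inj₂ (inj₁ j)) i = leaf≢centre (block T j) i ∘ inj₂-injective
    tip≢hub (inj₂ (inj₂ _)) i ()

    Edge : J → Fin e → V → V → Set
    Edge j i u v = (hub j ≡ u × tip j i ≡ v) ⊎ (hub j ≡ v × tip j i ≡ u)

    UniqueEdge : V → V → Set
    UniqueEdge u v = Σ J λ j → Σ (Fin e) λ i → Edge j i u v ×
                       (∀ j′ i′ → Edge j′ i′ u v → j′ ≡ j × i′ ≡ i)

    UniqueEdge-sym : ∀ {u v} → UniqueEdge u v → UniqueEdge v u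
    UniqueEdge-sym (j , i , E , !) = j , i , swap E , λ j′ i′ → ! j′ i′ ∘ swap

    -- Only a star centred at `u` can contain such an edge. The inverse of `β u` finds its index and
    -- leaf position, and the two inverse laws give existence and uniqueness.
    crossing : ∀ u v → UniqueEdge (inj₁ u) (inj₂ v)
    crossing u v with j , i ← from (β u) v in eq =
      inj₂ (inj₂ (u , j)) , i ,
      inj₁ (refl , cong inj₂ (trans (cong (to (β u)) (sym eq)) (strictlyInverseˡ (β u) v))) ,
      λ { (inj₁ _)        _ (inj₁ (_ , ()))
        ; (inj₁ _)        _ (inj₂ (() , _))
        ; (inj₂ (inj₁ _)) _ (inj₁ (() , _))
        ; (inj₂ (inj₁ _)) _ (inj₂ (_ , ()))
        ; (inj₂ (inj₂ (w , j′))) i′ (inj₁ (refl , refl)) →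
            let p = trans (sym (strictlyInverseʳ (β u) (j′ , i′))) eq
            in cong (λ x → inj₂ (inj₂ (u , x))) (,-injectiveˡ p) , ,-injectiveʳ p }

    uniqueEdge : ∀ u v → u ≢ v → UniqueEdge u v
    uniqueEdge (inj₁ u) (inj₁ v) u≢v with partition S u v (u≢v ∘ cong inj₁)
    ... | j , i , E , ! = inj₁ j , i ,
      Sum.map (λ { (p , r) → cong inj₁ p , cong inj₁ r }) (λ { (p , r) → cong inj₁ p , cong inj₁ r }) E ,
      λ { (inj₁ j′) i′ E′ →
            let r = ! j′ i′ (Sum.map (λ { (p , r) → inj₁-injective p , inj₁-injective r })
                                     (λ { (p , r) → inj₁-injective p , inj₁-injective r }) E′)
            in cong inj₁ (proj₁ r) , proj₂ r
        ; (inj₂ (inj₁ _)) _ (inj₁ (() , _))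
        ; (inj₂ (inj₁ _)) _ (inj₂ (() , _))
        ; (inj₂ (inj₂ _)) _ (inj₁ (_ , ()))
        ; (inj₂ (inj₂ _)) _ (inj₂ (_ , ())) }
    uniqueEdge (inj₂ u) (inj₂ v) u≢v with partition T u v (u≢v ∘ cong inj₂)
    ... | j , i , E , ! = inj₂ (inj₁ j) , i ,
      Sum.map (λ { (p , r) → cong inj₂ p , cong inj₂ r }) (λ { (p , r) → cong inj₂ p , cong inj₂ r }) E ,
      λ { (inj₂ (inj₁ j′)) i′ E′ →
            let r = ! j′ i′ (Sum.map (λ { (p , r) → inj₂-injective p , inj₂-injective r })
                                     (λ { (p , r) → inj₂-injective p , inj₂-injective r }) E′)
            in cong (inj₂ ∘ inj₁) (proj₁ r) , proj₂ r
        ; (inj₁ _) _ (inj₁ (() , _))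
        ; (inj₁ _) _ (inj₂ (() , _))
        ; (inj₂ (inj₂ _)) _ (inj₁ (() , _))
        ; (inj₂ (inj₂ _)) _ (inj₂ (() , _)) }
    uniqueEdge (inj₁ u) (inj₂ v) _ = crossing u v
    uniqueEdge (inj₂ u) (inj₁ v) _ = UniqueEdge-sym (crossing v u)

    σ : Fin (n₁ + n₂) ↔ V
    σ = +↔⊎

    τ : Fin (m S + (m T + n₁ * q)) ↔ J
    τ = (↔-id _ ⊎-↔ ((↔-id _ ⊎-↔ *↔×) ↔-∘ +↔⊎)) ↔-∘ +↔⊎

    from-σ-injective : ∀ {x y} → from σ x ≡ from σ y → x ≡ y
    from-σ-injective {x} {y} p = trans (sym (strictlyInverseˡ σ x)) (trans (cong (to σ) p) (strictlyInverseˡ σ y))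

    from⇒to : ∀ {x y} → from σ x ≡ y → x ≡ to σ y
    from⇒to {x} refl = sym (strictlyInverseˡ σ x)

    to⇒from : ∀ {x y} → x ≡ to σ y → from σ x ≡ y
    to⇒from {y = y} refl = strictlyInverseʳ σ y

    star : J → Star (n₁ + n₂) e
    star j = record
      { centre = from σ (hub j)
      ; leaf = from σ ∘ tip j
      ; leaf≢centre = λ i → tip≢hub j i ∘ from-σ-injective
      }

    edge⁺ : ∀ {j i u v} → Edge j i (to σ u) (to σ v) → EdgeOf (star j) i u v
    edge⁺ (inj₁ (p , r)) = inj₁ (to⇒from p , to⇒from r)
    edge⁺ (inj₂ (p , r)) = inj₂ (to⇒from p , to⇒from r)

    edge⁻ : ∀ {j i u v} → EdgeOf (star j) i u v → Edge j i (to σ u) (to σ v)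
    edge⁻ (inj₁ (p , r)) = inj₁ (from⇒to p , from⇒to r)
    edge⁻ (inj₂ (p , r)) = inj₂ (from⇒to p , from⇒to r)

  joined : StarSystem (n₁ + n₂) e
  joined = record
    { m = m S + (m T + n₁ * q)
    ; block = star ∘ to τ
    ; partition = λ u v u≢v →
        let to≢ = λ p → u≢v (trans (sym (to⇒from refl)) (to⇒from p))
            j , i , E , ! = uniqueEdge (to σ u) (to σ v) to≢
        in from τ j , i ,
           edge⁺ (subst (λ x → Edge x i (to σ u) (to σ v)) (sym (strictlyInverseˡ τ j)) E) ,
           λ j′ i′ E′ →
             let p , r = ! (to τ j′) i′ (edge⁻ E′)
             in trans (sym (strictlyInverseʳ τ j′)) (cong (from τ) p) , r
    }

  module _ {k} (c : Colouring (n₁ + n₂) k) where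

    Crossed : Set
    Crossed = ∀ v j → ¬ (∀ i → c (n₁ ↑ʳ to (β v) (j , i)) ≡ c (v ↑ˡ n₂))

    proper⁺ : Proper S (c ∘ (_↑ˡ n₂)) → Proper T (c ∘ (n₁ ↑ʳ_)) → Crossed → Proper joined c
    proper⁺ pS pT pX j = go (to τ j)
      where
        go : ∀ j → ¬ (∀ i → c (leaf (star j) i) ≡ c (centre (star j)))
        go (inj₁ j)              = pS j
        go (inj₂ (inj₁ j))       = pT j
        go (inj₂ (inj₂ (v , j))) = pX v j

    module _ (p : Proper joined c) where
      private
        star-proper : ∀ j → ¬ (∀ i → c (leaf (star j) i) ≡ c (centre (star j)))
        star-proper j = subst (λ x → ¬ (∀ i → c (leaf (star x) i) ≡ c (centre (star x))))
                              (strictlyInverseˡ τ j) (p (from τ j))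

      proper⁻ˡ : Proper S (c ∘ (_↑ˡ n₂))
      proper⁻ˡ = star-proper ∘ inj₁

      proper⁻ʳ : Proper T (c ∘ (n₁ ↑ʳ_))
      proper⁻ʳ = star-proper ∘ inj₂ ∘ inj₁

      proper⁻ˣ : Crossed
      proper⁻ˣ v j = star-proper (inj₂ (inj₂ (v , j)))

-- Counting in lists and splitting lists into groups.

count : {P : A → Set} → Decidable P → List A → ℕ
count P? xs = length (filter P? xs)

flat : List (Vec A e) → List A
flat = concatMap toList

count-++ : {P : A → Set} (P? : Decidable P) (xs ys : List A) → count P? (xs ++ ys) ≡ count P? xs + count P? ys
count-++ P? xs ys = trans (cong length (filter-++ P? xs ys)) (length-++ (filter P? xs))

count-↭ : {P : A → Set} (P? : Decidable P) {xs ys : List A} → xs ↭ ys → count P? xs ≡ count P? ys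
count-↭ P? = ↭-length ∘ filter-↭ P?

-- The removed elements `ls` contribute at most `length ls` to the count. The greedy choices below
-- use this to see that enough elements are left.
count-drop : {P : A → Set} (P? : Decidable P) {a b : ℕ} {xs rest : List A} (ls : List A) →
             xs ↭ ls ++ rest → length ls + a ≤ b → b ≤ count P? xs → a ≤ count P? rest
count-drop P? {a} {b} {xs} {rest} ls xs↭ ls+a≤b b≤ = +-cancelˡ-≤ (length ls) a (count P? rest) (begin
  length ls + a               ≤⟨ ls+a≤b ⟩
  b                           ≤⟨ b≤ ⟩
  count P? xs                 ≡⟨ count-↭ P? xs↭ ⟩
  count P? (ls ++ rest)       ≡⟨ count-++ P? ls rest ⟩
  count P? ls + count P? rest ≤⟨ +-monoˡ-≤ _ (length-filter P? ls) ⟩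
  length ls + count P? rest   ∎)
  where open ≤-Reasoning

length-split : ∀ {xs rest : List A} (g : Vec A r) → xs ↭ toList g ++ rest → length xs ≡ r + length rest
length-split g xs↭ = trans (↭-length xs↭) (trans (length-++ (toList g)) (cong (_+ _) (length-toList g)))

pick : {P : A → Set} (P? : Decidable P) (r : ℕ) (xs : List A) → r ≤ count P? xs →
       ∃₂ λ (g : Vec A r) rest → xs ↭ toList g ++ rest × All P (toList g)
pick P? zero    xs       _ = [] , xs , ↭-refl , []
pick P? (suc r) (x ∷ xs) r<count with P? x
... | yes px with g , rest , p , all ← pick P? r xs (≤-pred r<count)
    = x ∷ g , rest , prep x p , px ∷ all
... | no  _  with g , rest , p , all ← pick P? (suc r) xs r<count
    = g , x ∷ rest , ↭-trans (prep x p) (↭-sym (shift x (toList g) rest)) , all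

-- The groups are chosen one after another. Each earlier group takes at most `e` elements satisfying
-- a later predicate, so `k * e` of them suffice.
pickEach : ∀ {k} {P : Fin k → A → Set} (P? : ∀ b → Decidable (P b)) (xs : List A) →
           (∀ b → k * e ≤ count (P? b) xs) →
           ∃₂ λ (G : Fin k → Vec A e) rest → xs ↭ flat (tabulate G) ++ rest × (∀ b → All (P b) (toList (G b)))
pickEach {k = zero}  P? xs _ = (λ ()) , xs , ↭-refl , λ ()
pickEach {e = e} {k = suc k} P? xs enough
  with g , ys , xs↭ , all ← pick (P? zero) e xs (≤-trans (m≤m+n e (k * e)) (enough zero))
  with G , rest , ys↭ , alls ← pickEach (P? ∘ suc) ys (λ b → count-drop (P? (suc b)) (toList g) xs↭
         (≤-reflexive (cong (_+ k * e) (length-toList g))) (enough (suc b)))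
  = (λ { zero → g ; (suc b) → G b }) , rest ,
    ↭-trans xs↭ (↭-trans (++⁺ˡ (toList g) ys↭) (↭-reflexive (sym (++-assoc (toList g) (flat (tabulate G)) rest)))) ,
    λ { zero → all ; (suc b) → alls b }

length-flat : (G : List (Vec A e)) → length (flat G) ≡ length G * e
length-flat []      = refl
length-flat (g ∷ G) = trans (length-++ (toList g)) (cong₂ _+_ (length-toList g) (length-flat G))

takeVec : ∀ r {s} (xs : List A) → length xs ≡ r + s →
          ∃₂ λ (g : Vec A r) rest → xs ≡ toList g ++ rest × length rest ≡ s
takeVec zero    xs       eq = [] , xs , refl , eq
takeVec (suc r) (x ∷ xs) eq with g , rest , refl , eq′ ← takeVec r xs (ℕ.suc-injective eq)
  = x ∷ g , rest , refl , eq′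

distribute : ∀ {P : A → Set} {q} (hs : Vec A q) (rs : List A) → length rs ≡ q * e →
             ∃ λ (G : List (Vec A (suc e))) → toList hs ++ rs ↭ flat G × (All P (toList hs) → All (P ∘ head) G)
distribute         []       []  _  = [] , ↭-refl , λ _ → []
distribute {e = e} (h ∷ hs) rs eq
  with g , rs′ , refl , eq′ ← takeVec e rs eq
  with G , p , all ← distribute hs rs′ eq′
  = (h ∷ g) ∷ G , prep h (↭-trans (shifts (toList hs) (toList g)) (++⁺ˡ (toList g) p)) ,
    λ { (ph ∷ phs) → ph ∷ all phs }

-- Heads satisfying P are chosen first; the other elements are then dealt out arbitrarily.
fill : {P : A → Set} (P? : Decidable P) (xs : List A) (q : ℕ) → length xs ≡ q * suc e → q ≤ count P? xs →
       ∃ λ (G : List (Vec A (suc e))) → xs ↭ flat G × All (P ∘ head) G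
fill {e = e} P? xs q len q≤
  with hs , rs , xs↭ , all ← pick P? q xs q≤
  with G , p , alls ← distribute hs rs (+-cancelˡ-≡ q (length rs) (q * e)
         (trans (sym (length-split hs xs↭)) (trans len (*-suc q e))))
  = G , ↭-trans xs↭ p , alls all

-- Partitions into groups as bijections.

Unique-++⁻ : ∀ (xs : List A) {ys} → Unique (xs ++ ys) → Unique xs × Unique ys × Disjoint xs ys
Unique-++⁻ []       u = [] , u , λ { (() , _) }
Unique-++⁻ (x ∷ xs) (x∉ ∷ u) with u₁ , u₂ , # ← Unique-++⁻ xs u
  = All.++⁻ˡ xs x∉ ∷ u₁ , u₂ ,
    λ { (here refl , v∈ys) → All.lookup (All.++⁻ʳ xs x∉) v∈ys refl ; (there v∈xs , v∈ys) → # (v∈xs , v∈ys) }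

∈-toList-lookup : (g : Vec A r) (i : Fin r) → Vec.lookup g i ∈ toList g
∈-toList-lookup (x ∷ g) zero    = here refl
∈-toList-lookup (x ∷ g) (suc i) = there (∈-toList-lookup g i)

lookup-toList-∈ : (g : Vec A r) {x : A} → x ∈ toList g → ∃ λ i → Vec.lookup g i ≡ x
lookup-toList-∈ (x ∷ g) (here refl) = zero , refl
lookup-toList-∈ (x ∷ g) (there x∈) with i , eq ← lookup-toList-∈ g x∈ = suc i , eq

lookup-injective : (g : Vec A r) → Unique (toList g) → ∀ {i j} → Vec.lookup g i ≡ Vec.lookup g j → i ≡ j
lookup-injective (x ∷ g) (x∉ ∷ u) {zero}  {zero}  eq = refl
lookup-injective (x ∷ g) (x∉ ∷ u) {zero}  {suc j} eq = contradiction eq (All.lookup x∉ (∈-toList-lookup g j))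
lookup-injective (x ∷ g) (x∉ ∷ u) {suc i} {zero}  eq = contradiction (sym eq) (All.lookup x∉ (∈-toList-lookup g i))
lookup-injective (x ∷ g) (x∉ ∷ u) {suc i} {suc j} eq = cong suc (lookup-injective g u eq)

entry : (G : List (Vec A e)) → Fin (length G) × Fin e → A
entry G (j , i) = Vec.lookup (lookup G j) i

entry-∈ : (G : List (Vec A e)) (p : Fin (length G) × Fin e) → entry G p ∈ flat G
entry-∈ (g ∷ G) (zero  , i) = ∈-++⁺ˡ (∈-toList-lookup g i)
entry-∈ (g ∷ G) (suc j , i) = ∈-++⁺ʳ (toList g) (entry-∈ G (j , i))

entry-surjective : (G : List (Vec A e)) {x : A} → x ∈ flat G → ∃ λ p → entry G p ≡ x
entry-surjective (g ∷ G) x∈ with ∈-++⁻ (toList g) x∈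
... | inj₁ x∈g with i , eq ← lookup-toList-∈ g x∈g       = (zero , i) , eq
... | inj₂ x∈G with (j , i) , eq ← entry-surjective G x∈G = (suc j , i) , eq

entry-injective : (G : List (Vec A e)) → Unique (flat G) → ∀ {p p′} → entry G p ≡ entry G p′ → p ≡ p′
entry-injective (g ∷ G) u {j , i} {j′ , i′} eq with Unique-++⁻ (toList g) u
entry-injective (g ∷ G) _ {zero  , i} {zero   , i′} eq | u , _ , _ = cong (zero ,_) (lookup-injective g u eq)
entry-injective (g ∷ G) _ {zero  , i} {suc j′ , i′} eq | _ , _ , # =
  contradiction (∈-toList-lookup g i , subst (_∈ flat G) (sym eq) (entry-∈ G (j′ , i′))) #
entry-injective (g ∷ G) _ {suc j , i} {zero   , i′} eq | _ , _ , # =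
  contradiction (∈-toList-lookup g i′ , subst (_∈ flat G) eq (entry-∈ G (j , i))) #
entry-injective (g ∷ G) _ {suc j , i} {suc j′ , i′} eq | _ , u , _ with refl ← entry-injective G u eq = refl

-- As a permutation of `allFin n`, the flattened list has no repetitions and omits nothing, so
-- `entry G` is injective and surjective.
entries : (G : List (Vec (Fin n) e)) → allFin n ↭ flat G → (Fin (length G) × Fin e) ↔ Fin n
entries {n} G p = mk↔ₛ′ (entry G) (proj₁ ∘ locate) (proj₂ ∘ locate)
                    (λ x → entry-injective G unique (proj₂ (locate (entry G x))))
  where
    locate : ∀ v → ∃ λ x → entry G x ≡ v
    locate v = entry-surjective G (∈-resp-↭ p (∈-allFin v))

    unique : Unique (flat G)
    unique = PermutationSetoid.Unique-resp-↭ (setoid (Fin n)) (↭⇒↭ₛ p) (allFin⁺ n)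

-- Comparing lengths gives `length G ≡ q`, so the bijection has the index type that joining
-- requires. The first clause transfers properties of all groups to the stars; the second finds the
-- star that belongs to a given group.
grouping : ∀ {q} (G : List (Vec (Fin n) (suc e))) → allFin n ↭ flat G → n ≡ q * suc e →
           Σ ((Fin q × Fin (suc e)) ↔ Fin n) λ β →
             (∀ j → ∃ λ g → g ∈ G × ∀ i → to β (j , i) ≡ Vec.lookup g i) ×
             (∀ {g} → g ∈ G → ∃ λ j → ∀ i → to β (j , i) ≡ Vec.lookup g i)
grouping {n = n} {e = e} {q = q} G p n≡
  with refl ← *-cancelʳ-≡ (length G) q (suc e) (trans (sym (length-flat G))
                (trans (sym (↭-length p)) (trans (length-tabulate {n = n} id) n≡)))
  = entries G p ,
    (λ j → lookup G j , ∈-lookup j , λ _ → refl) ,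
    λ {g} g∈ → index g∈ , λ i → cong (λ g → Vec.lookup g i) (sym (lookup-index g∈))

-- Counting vertices by colour.

count-map : {A B : Set} {P : B → Set} (P? : Decidable P) (f : A → B) (xs : List A) →
            count P? (map f xs) ≡ count (P? ∘ f) xs
count-map P? f []       = refl
count-map P? f (x ∷ xs) with P? (f x)
... | yes _ = cong suc (count-map P? f xs)
... | no  _ = count-map P? f xs

count-cong : {A : Set} {P Q : A → Set} (P? : Decidable P) (Q? : Decidable Q) →
             (∀ x → P x → Q x) → (∀ x → Q x → P x) → (xs : List A) → count P? xs ≡ count Q? xs
count-cong P? Q? P⇒Q Q⇒P []       = refl
count-cong P? Q? P⇒Q Q⇒P (x ∷ xs) with P? x | Q? x
... | yes _ | yes _ = cong suc (count-cong P? Q? P⇒Q Q⇒P xs)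
... | no  _ | no  _ = count-cong P? Q? P⇒Q Q⇒P xs
... | yes p | no ¬q = contradiction (P⇒Q x p) ¬q
... | no ¬p | yes q = contradiction (Q⇒P x q) ¬p

count-∈ : {A : Set} {P : A → Set} (P? : Decidable P) {x : A} {xs : List A} → x ∈ xs → P x → 1 ≤ count P? xs
count-∈ P? {xs = y ∷ _} x∈ px with P? y
count-∈ P? x∈          px | yes _  = s≤s z≤n
count-∈ P? (here refl) px | no ¬py = contradiction px ¬py
count-∈ P? (there x∈)  px | no _   = count-∈ P? x∈ px

count-¬ : {A : Set} {P : A → Set} (P? : Decidable P) (xs : List A) → length xs ≡ count P? xs + count (¬? ∘ P?) xs
count-¬ P? []       = refl
count-¬ P? (x ∷ xs) with P? x
... | yes _ = cong suc (count-¬ P? xs)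
... | no  _ = trans (cong suc (count-¬ P? xs)) (sym (+-suc _ _))

count-disjoint : {A : Set} {P Q R : A → Set} (P? : Decidable P) (Q? : Decidable Q) (R? : Decidable R) →
                 (∀ x → P x → R x) → (∀ x → Q x → R x) → (∀ x → P x → ¬ Q x) →
                 (xs : List A) → count P? xs + count Q? xs ≤ count R? xs
count-disjoint P? Q? R? P⇒R Q⇒R P#Q []       = z≤n
count-disjoint P? Q? R? P⇒R Q⇒R P#Q (x ∷ xs) with ih ← count-disjoint P? Q? R? P⇒R Q⇒R P#Q xs | P? x | Q? x | R? x
... | yes p | yes q | _     = contradiction q (P#Q x p)
... | yes p | no  _ | yes _ = s≤s ih
... | no  _ | yes q | yes _ = ≤-trans (≤-reflexive (+-suc _ _)) (s≤s ih)
... | yes p | no  _ | no ¬r = contradiction (P⇒R x p) ¬r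
... | no  _ | yes q | no ¬r = contradiction (Q⇒R x q) ¬r
... | no  _ | no  _ | yes _ = m≤n⇒m≤1+n ih
... | no  _ | no  _ | no  _ = ih

allFin-+ : ∀ m n → allFin (m + n) ≡ map (_↑ˡ n) (allFin m) ++ map (m ↑ʳ_) (allFin n)
allFin-+ m n = trans (tabulate-+ m id) (sym (cong₂ _++_ (map-tabulate id (_↑ˡ n)) (map-tabulate id (m ↑ʳ_))))
  where
    tabulate-+ : ∀ {A : Set} m (f : Fin (m + n) → A) → tabulate f ≡ tabulate (f ∘ (_↑ˡ n)) ++ tabulate (f ∘ (m ↑ʳ_))
    tabulate-+ zero    f = refl
    tabulate-+ (suc m) f = cong (f zero ∷_) (tabulate-+ m (f ∘ suc))

-- A predicate on colours covers both a class, where it unfolds to `classSize`, and the complement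
-- of a class.
tally : {P : Fin k → Set} → Decidable P → Colouring n k → ℕ
tally {n = n} P? c = count (P? ∘ c) (allFin n)

tally-+ : ∀ l {P : Fin k → Set} (P? : Decidable P) (c : Colouring (l + n) k) →
          tally P? c ≡ tally P? (c ∘ (_↑ˡ n)) + tally P? (c ∘ (l ↑ʳ_))
tally-+ {n = n} l P? c = trans (cong (count (P? ∘ c)) (allFin-+ l n))
  (trans (count-++ (P? ∘ c) (map (_↑ˡ n) (allFin l)) (map (l ↑ʳ_) (allFin n)))
    (cong₂ _+_ (count-map (P? ∘ c) (_↑ˡ n) (allFin l)) (count-map (P? ∘ c) (l ↑ʳ_) (allFin n))))

tally-cong : {P : Fin k → Set} (P? : Decidable P) {c c′ : Colouring n k} → c ≗ c′ → tally P? c ≡ tally P? c′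
tally-cong {n = n} {P} P? c≗ = count-cong _ _ (λ x → subst P (c≗ x)) (λ x → subst P (sym (c≗ x))) (allFin n)

infixr 5 _∣∣_
_∣∣_ : Colouring l k → Colouring n k → Colouring (l + n) k
c₁ ∣∣ c₂ = [ c₁ , c₂ ]′ ∘ splitAt _

∣∣-ˡ : (c₁ : Colouring l k) (c₂ : Colouring n k) → (c₁ ∣∣ c₂) ∘ (_↑ˡ n) ≗ c₁
∣∣-ˡ {l = l} {n = n} c₁ c₂ x = cong [ c₁ , c₂ ]′ (splitAt-↑ˡ l x n)

∣∣-ʳ : (c₁ : Colouring l k) (c₂ : Colouring n k) → (c₁ ∣∣ c₂) ∘ (l ↑ʳ_) ≗ c₂
∣∣-ʳ {l = l} {n = n} c₁ c₂ x = cong [ c₁ , c₂ ]′ (splitAt-↑ʳ l n x)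

tally-∣∣ : {P : Fin k → Set} (P? : Decidable P) (c₁ : Colouring l k) (c₂ : Colouring n k) →
           tally P? (c₁ ∣∣ c₂) ≡ tally P? c₁ + tally P? c₂
tally-∣∣ {l = l} P? c₁ c₂ = trans (tally-+ l P? (c₁ ∣∣ c₂))
  (cong₂ _+_ (tally-cong P? (∣∣-ˡ c₁ c₂)) (tally-cong P? (∣∣-ʳ c₁ c₂)))

-- Proper colourings of joins and the sizes of colour classes.

proper-cong : ∀ {e} (S : StarSystem n e) {c c′ : Colouring n k} → c ≗ c′ → Proper S c → Proper S c′
proper-cong S c≗ p j mono = p j (λ i → trans (c≗ _) (trans (mono i) (sym (c≗ _))))

-- The condition under which a star with leaf set `g` and a centre of colour `d` respects `c`.
Mixed : ∀ {e} → Colouring n k → Fin k → Vec (Fin n) e → Set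
Mixed c d g = ∃ λ i → c (Vec.lookup g i) ≢ d

joinedColouring-proper : ∀ {n₁ n₂ e q} (S : StarSystem n₁ e) (T : StarSystem n₂ e)
  (β : Fin n₁ → (Fin q × Fin e) ↔ Fin n₂) (c₁ : Colouring n₁ k) (c₂ : Colouring n₂ k) →
  Proper S c₁ → Proper T c₂ →
  (∀ v j → ∃ λ i → c₂ (to (β v) (j , i)) ≢ c₁ v) →
  Proper (Join.joined S T β) (c₁ ∣∣ c₂)
joinedColouring-proper S T β c₁ c₂ p₁ p₂ mixed = Join.proper⁺ S T β (c₁ ∣∣ c₂)
  (proper-cong S (sym ∘ ∣∣-ˡ c₁ c₂) p₁) (proper-cong T (sym ∘ ∣∣-ʳ c₁ c₂) p₂)
  λ v j mono → let i , ≢ = mixed v j in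
    ≢ (trans (sym (∣∣-ʳ c₁ c₂ _)) (trans (mono i) (∣∣-ˡ c₁ c₂ v)))

-- A missed colour could be punched out, which would leave a proper colouring with `k` colours.
proper-surjective : ∀ {e} (S : StarSystem n e) → ¬ Colourable S k → (c : Colouring n (suc k)) → Proper S c →
                    ∀ a → ∃ λ x → c x ≡ a
proper-surjective S ¬k c p a with any? (λ x → c x ≟ a)
... | yes hit = hit
... | no miss = contradiction
        ((λ x → punchOut (a≢ x)) , λ j mono → p j (λ i → punchOut-injective (a≢ _) (a≢ _) (mono i))) ¬k
  where
    a≢ : ∀ x → a ≢ c x
    a≢ x eq = miss (x , sym eq)

classSize-∈ : (c : Colouring n k) (x : Fin n) {a : Fin k} → c x ≡ a → 1 ≤ classSize c a
classSize-∈ c x = count-∈ _ (∈-allFin x)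

-- Each class has at most n / 3 elements and q ≤ n / 3, so at least 2q elements lie outside of a given class.
spare : ∀ {k e q} → 3 ≤ k → 3 ≤ e → n ≡ q * e → (c : Colouring n k) → StronglyEquitable c →
        (∀ a → 1 ≤ classSize c a) → ∀ d → q + 1 ≤ tally (¬? ∘ (_≟ d)) c
spare {n = n} {suc (suc (suc k))} {e} {q} (s≤s (s≤s (s≤s _))) 3≤e n≡ c se nonempty d = bound
  where
    open ≤-Reasoning
    a b : Fin (3 + k)
    a = punchIn d zero
    b = punchIn d (suc zero)
    s N : ℕ
    s = classSize c d
    N = tally (¬? ∘ (_≟ d)) c

    s+s≤N : s + s ≤ N
    s+s≤N = begin
      s + s                         ≡⟨ cong₂ _+_ (se d a) (se d b) ⟩
      classSize c a + classSize c b ≤⟨ count-disjoint _ _ _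
                                         (λ x p r → punchInᵢ≢i d zero (trans (sym p) r))
                                         (λ x p r → punchInᵢ≢i d (suc zero) (trans (sym p) r))
                                         (λ x p r → contradiction (punchIn-injective d zero (suc zero) (trans (sym p) r)) λ ())
                                         (allFin n) ⟩
      N                             ∎

    n≡s+N : n ≡ s + N
    n≡s+N = trans (sym (length-tabulate {n = n} id)) (count-¬ ((_≟ d) ∘ c) (allFin n))

    3q≤ : q * 3 ≤ s + N
    3q≤ = begin
      q * 3 ≤⟨ *-monoʳ-≤ q 3≤e ⟩
      q * e ≡⟨ n≡ ⟨
      n     ≡⟨ n≡s+N ⟩
      s + N ∎

    bound : q + 1 ≤ N
    bound with q + 1 ≤? N
    ... | yes p = p
    -- If `N ≤ q`, doubling `3q ≤ s + N` and using `s + s ≤ N` gives `6q ≤ 3N ≤ 3q`, which is absurd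
    -- for positive `q`.
    ... | no ¬p = contradiction (begin-strict
      q * 3 + q * 3         ≤⟨ +-mono-≤ 3q≤ 3q≤ ⟩
      (s + N) + (s + N)     ≡⟨ +-comm-middle s N ⟩
      (s + s) + (N + N)     ≤⟨ +-monoˡ-≤ (N + N) s+s≤N ⟩
      N + (N + N)           ≤⟨ +-mono-≤ N≤q (+-mono-≤ N≤q N≤q) ⟩
      q + (q + q)           <⟨ +-monoʳ-< q (+-monoʳ-< q (m<m+n q q>0)) ⟩
      q + (q + (q + q))     ≤⟨ m≤m+n _ (q + q) ⟩
      q + (q + (q + q)) + (q + q) ≡⟨ six q ⟩
      q * 3 + q * 3         ∎) (<-irrefl refl)
      where
        +-comm-middle : ∀ s N → (s + N) + (s + N) ≡ (s + s) + (N + N)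
        +-comm-middle = solve-∀
        six : ∀ q → q + (q + (q + q)) + (q + q) ≡ q * 3 + q * 3
        six = solve-∀
        N≤q : N ≤ q
        N≤q = ≤-pred (≤-trans (≰⇒> ¬p) (≤-reflexive (+-comm q 1)))
        q>0 : 0 < q
        q>0 = ≤-trans (≤-trans (nonempty d) (m≤m+n s s)) (≤-trans s+s≤N N≤q)

-- Iterated joins of copies of the given system.

module _ {k e n₀} (3≤k : 3 ≤ suc k) (3≤e : 3 ≤ suc e) (2e∣n₀ : 2 * suc e ∣ n₀)
         (S : StarSystem n₀ (suc e)) (¬k : ¬ Colourable S k)
         (c₀ : Colouring n₀ (suc k)) (c₀-proper : Proper S c₀) (c₀-equitable : StronglyEquitable c₀) where

  -- `large` concerns all proper colourings because it is later applied to restrictions of arbitrary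
  -- colourings of the final system. `copy-onto` supplies a centre of every colour in each copy.
  record Copies (t : ℕ) : Set where
    field
      order     : ℕ
      system    : StarSystem order (suc e)
      colouring : Colouring order (suc k)
      proper    : Proper system colouring
      equitable : StronglyEquitable colouring
      q         : ℕ
      order≡    : order ≡ q * suc e
      2e∣order  : 2 * suc e ∣ order
      -- each of the q groups around a centre of colour d needs an element of another colour
      room      : ∀ d → q + t ≤ tally (¬? ∘ (_≟ d)) colouring
      large     : ∀ (c : Colouring order (suc k)) → Proper system c → ∀ a → t ≤ classSize c a
      copy      : Fin order → Fin t
      copy-onto : ∀ j a → ∃ λ y → copy y ≡ j × colouring y ≡ a

  copies : ∀ t → Copies t
  copies zero = record
    { order = 0
    ; system = record { m = 0 ; block = λ () ; partition = λ () }
    ; colouring = λ ()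
    ; proper = λ ()
    ; equitable = λ _ _ → refl
    ; q = 0
    ; order≡ = refl
    ; 2e∣order = _ ∣0
    ; room = λ _ → z≤n
    ; large = λ _ _ _ → z≤n
    ; copy = λ ()
    ; copy-onto = λ ()
    }
  copies (suc t) = record
    { order = n₀ + order
    ; system = Join.joined S system β
    ; colouring = c₀ ∣∣ colouring
    ; proper = joinedColouring-proper S system β c₀ colouring c₀-proper proper mixed
    ; equitable = λ a b → trans (tally-∣∣ (_≟ a) c₀ colouring)
        (trans (cong₂ _+_ (c₀-equitable a b) (equitable a b)) (sym (tally-∣∣ (_≟ b) c₀ colouring)))
    ; q = q₀ + q
    ; order≡ = trans (cong₂ _+_ n₀≡ order≡) (sym (*-distribʳ-+ (suc e) q₀ q))
    ; 2e∣order = ∣m∣n⇒∣m+n 2e∣n₀ 2e∣order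
    -- `spare` provides `q₀ + 1` elements in the new copy, so the surplus over the number of groups
    -- grows by one.
    ; room = λ d → begin
        (q₀ + q) + suc t                                             ≡⟨ rearrange q₀ q t ⟩
        (q₀ + 1) + (q + t)                                           ≤⟨ +-mono-≤ (room₀ d) (room d) ⟩
        tally (¬? ∘ (_≟ d)) c₀ + tally (¬? ∘ (_≟ d)) colouring       ≡⟨ tally-∣∣ (¬? ∘ (_≟ d)) c₀ colouring ⟨
        tally (¬? ∘ (_≟ d)) (c₀ ∣∣ colouring)                        ∎
    ; large = λ c p a → begin
        1 + t
          ≤⟨ +-mono-≤ (nonempty _ (Join.proper⁻ˡ S system β c p) a) (large _ (Join.proper⁻ʳ S system β c p) a) ⟩
        classSize (c ∘ (_↑ˡ order)) a + classSize (c ∘ (n₀ ↑ʳ_)) a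
          ≡⟨ tally-+ n₀ (_≟ a) c ⟨
        classSize c a ∎
    ; copy = [ (λ _ → zero) , suc ∘ copy ]′ ∘ splitAt n₀
    ; copy-onto = onto
    }
    where
    open Copies (copies t)
    open ≤-Reasoning

    rearrange : ∀ a b c → (a + b) + suc c ≡ (a + 1) + (b + c)
    rearrange = solve-∀

    e∣n₀ : suc e ∣ n₀
    e∣n₀ = ∣-trans (n∣m*n 2) 2e∣n₀

    q₀ = _∣_.quotient e∣n₀
    n₀≡ = _∣_.equality e∣n₀

    nonempty : ∀ (c : Colouring n₀ (suc k)) → Proper S c → ∀ a → 1 ≤ classSize c a
    nonempty c p a = let x , eq = proper-surjective S ¬k c p a in classSize-∈ c x eq

    room₀ : ∀ d → q₀ + 1 ≤ tally (¬? ∘ (_≟ d)) c₀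
    room₀ = spare 3≤k 3≤e n₀≡ c₀ c₀-equitable (nonempty c₀ c₀-proper)

    -- A head of another colour makes a group mixed. Only `q` heads are needed here; the surplus `t`
    -- matters in the final join.
    filling : ∀ d → ∃ λ G → allFin order ↭ flat G × All (Mixed colouring d) G
    filling d =
      let G , p , all = fill (λ x → ¬? (colouring x ≟ d)) (allFin order) q
                          (trans (length-tabulate {n = order} id) order≡) (≤-trans (m≤m+n q t) (room d))
      in G , p , All.map (λ { {_ ∷ _} ≢d → zero , ≢d }) all

    arranged : ∀ v → _
    arranged v = let G , p , _ = filling (c₀ v) in grouping G p order≡

    β : Fin n₀ → (Fin q × Fin (suc e)) ↔ Fin order
    β v = proj₁ (arranged v)

    mixed : ∀ v j → ∃ λ i → colouring (to (β v) (j , i)) ≢ c₀ v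
    mixed v j =
      let g , g∈ , at = proj₁ (proj₂ (arranged v)) j
          i , ≢c = All.lookup (proj₂ (proj₂ (filling (c₀ v)))) g∈
      in i , λ eq → ≢c (trans (cong colouring (sym (at i))) eq)

    onto : ∀ j a → ∃ λ y → [ (λ _ → zero) , suc ∘ copy ]′ (splitAt n₀ y) ≡ j × (c₀ ∣∣ colouring) y ≡ a
    onto zero a with x , eq ← proper-surjective S ¬k c₀ c₀-proper a
      = x ↑ˡ order , cong [ _ , _ ]′ (splitAt-↑ˡ n₀ x order) , trans (∣∣-ˡ c₀ colouring x) eq
    onto (suc j) a with y , eq , eq′ ← copy-onto j a
      = n₀ ↑ʳ y , trans (cong [ _ , _ ]′ (splitAt-↑ʳ n₀ order y)) (cong suc eq) , trans (∣∣-ʳ c₀ colouring y) eq′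

-- Monochromatic groups, pigeonhole arguments and permutations of colours.

Mono : Colouring n k → Fin k → Vec (Fin n) e → Set
Mono c b g = ∀ i → c (Vec.lookup g i) ≡ b

all⇒mono : (c : Colouring n k) {b : Fin k} (g : Vec (Fin n) e) → All (λ x → c x ≡ b) (toList g) → Mono c b g
all⇒mono c g all i = All.lookup all (∈-toList-lookup g i)

∈⇒↭ : {A : Set} {x : A} {xs : List A} → x ∈ xs → ∃ λ rest → xs ↭ x ∷ rest
∈⇒↭ {x = x} x∈ with ys , zs , refl ← ∈-∃++ x∈ = ys ++ zs , shift x ys zs

occurs : (c : Colouring n k) (a : Fin k) → 1 ≤ classSize c a → ∃ λ x → c x ≡ a
occurs {n = n} c a 1≤size with x ∷ [] , _ , _ , eq ∷ [] ← pick (λ x → c x ≟ a) 1 (allFin n) 1≤size = x , eq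

-- If every `d` had a preimage, choosing one for each would inject `suc k` elements into `k`.
missed : (f : Fin k → Fin (suc k)) → ∃ λ d → ∀ b → f b ≢ d
missed {k} f
  with d , ¬hit ← ¬∀⟶∃¬ (suc k) (λ d → ∃ λ b → f b ≡ d) (λ d → any? (λ b → f b ≟ d))
         (λ hit → 1+n≰n (injective⇒≤ {f = proj₁ ∘ hit} (λ {x} {y} eq →
           trans (sym (proj₂ (hit x))) (trans (cong f eq) (proj₂ (hit y))))))
  = d , λ b eq → ¬hit (b , eq)

injective⇒surjective : (f : Fin k → Fin k) → (∀ {x y} → f x ≡ f y → x ≡ y) → ∀ a → ∃ λ x → f x ≡ a
injective⇒surjective {suc k} f inj a with any? (λ x → f x ≟ a)
... | yes hit = hit
... | no miss = contradiction
  (injective⇒≤ {f = λ x → punchOut (a≢ x)} (λ eq → inj (punchOut-injective (a≢ _) (a≢ _) eq))) 1+n≰n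
  where
    a≢ : ∀ x → a ≢ f x
    a≢ x eq = miss (x , sym eq)

-- By `refines`, the `c`-colour of a vertex depends only on its `c′`-colour, which makes `ρ` a left
-- inverse of `σ`. So `σ` is injective, and on a finite set of colours it is then bijective.
recolouring : (c c′ : Colouring n k) → (∀ a → ∃ λ x → c x ≡ a) → (∀ a → ∃ λ x → c′ x ≡ a) →
              (∀ u v → c′ u ≡ c′ v → c u ≡ c v) → Σ (Permutation′ k) λ π → ∀ x → c′ x ≡ π ⟨$⟩ʳ c x
recolouring {k = k} c c′ c-onto c′-onto refines =
  permutation σ ρ σρ ρσ , λ x → trans (sym (σρ (c′ x))) (cong σ (ρc′ x))
  where
    σ ρ : Fin k → Fin k
    σ b = c′ (proj₁ (c-onto b))
    ρ a = c (proj₁ (c′-onto a))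

    ρc′ : ∀ x → ρ (c′ x) ≡ c x
    ρc′ x = refines _ x (proj₂ (c′-onto (c′ x)))

    ρσ : ∀ b → ρ (σ b) ≡ b
    ρσ b = trans (ρc′ _) (proj₂ (c-onto b))

    σρ : ∀ a → σ (ρ a) ≡ a
    σρ a with b , refl ← injective⇒surjective σ (λ eq → trans (sym (ρσ _)) (trans (cong ρ eq) (ρσ _))) a
      = cong σ (ρσ b)

-- Arrangements of leaf sets around one new vertex.

record Arrangement {n k} e (c : Colouring n k) (d : Fin k) : Set where
  field
    groups  : List (Vec (Fin n) (suc e))
    perm    : allFin n ↭ flat groups
    mixed   : All (Mixed c d) groups
    -- When the old vertices are coloured by `c`, these groups exclude every colour but `d` for the
    -- centre.
    forcing : ∀ b → d ≢ b → ∃ λ g → g ∈ groups × Mono c b g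

open Arrangement

-- Half of the t elements to spare absorbs the prescribed groups L, the other half the groups that force the centre's colour.
module Arranging {n k e q t} (c : Colouring n (suc k)) (n≡ : n ≡ q * suc e)
                 (t≡ : t ≡ suc k * suc e + suc k * suc e)
                 (room : ∀ d → q + t ≤ tally (¬? ∘ (_≟ d)) c) (large : ∀ b → t ≤ classSize c b) where

  module _ (d : Fin (suc k)) (L : List (Vec (Fin n) (suc e))) (|L|≤ : length L ≤ suc k)
           (mixedL : All (Mixed c d) L) where

    module _ (F : Fin k → Vec (Fin n) (suc e)) {rest} (p : allFin n ↭ flat (L ++ tabulate F) ++ rest)
             (monoF : ∀ b → Mono c (punchIn d b) (F b)) where

      private
        LF : List (Vec (Fin n) (suc e))
        LF = L ++ tabulate F

        |LF| : length (flat LF) ≤ t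
        |LF| = begin
          length (flat LF)              ≡⟨ length-flat LF ⟩
          length LF * suc e             ≡⟨ cong (_* suc e) (trans (length-++ L) (cong (length L +_) (length-tabulate F))) ⟩
          (length L + k) * suc e        ≤⟨ *-monoˡ-≤ (suc e) (+-mono-≤ |L|≤ (n≤1+n k)) ⟩
          (suc k + suc k) * suc e       ≡⟨ *-distribʳ-+ (suc e) (suc k) (suc k) ⟩
          suc k * suc e + suc k * suc e ≡⟨ t≡ ⟨
          t                             ∎
          where open ≤-Reasoning

        length-n : q * suc e ≡ length LF * suc e + length rest
        length-n = trans (sym (trans (length-tabulate {n = n} id) n≡))
          (trans (↭-length p) (trans (length-++ (flat LF)) (cong (_+ length rest) (length-flat LF))))

        e∣rest : suc e ∣ length rest
        e∣rest = ∣m+n∣m⇒∣n (subst (suc e ∣_) length-n (n∣m*n q)) (n∣m*n (length LF))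

        q′≤q : ∀ q′ → length rest ≡ q′ * suc e → q′ ≤ q
        q′≤q q′ eq = *-cancelʳ-≤ q′ q (suc e) (≤-trans (≤-reflexive (sym eq))
          (≤-trans (m≤n+m (length rest) (length LF * suc e)) (≤-reflexive (sym length-n))))

        filling : ∀ q′ → length rest ≡ q′ * suc e →
                  ∃ λ (H : List (Vec (Fin n) (suc e))) → rest ↭ flat H × All (λ g → c (head g) ≢ d) H
        filling q′ eq = fill (λ x → ¬? (c x ≟ d)) rest q′ eq
          (≤-trans (q′≤q q′ eq) (count-drop (λ x → ¬? (c x ≟ d)) (flat LF) p
            (≤-trans (+-monoˡ-≤ q |LF|) (≤-reflexive (+-comm t q))) (room d)))

        assemble : (∃ λ (H : List (Vec (Fin n) (suc e))) → rest ↭ flat H × All (λ g → c (head g) ≢ d) H) →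
                   Σ (Arrangement e c d) λ A → ∀ {g} → g ∈ L → g ∈ groups A
        assemble (H , r , heads) = record
          { groups = LF ++ H
          ; perm = ↭-trans p (↭-trans (++⁺ˡ (flat LF) r) (↭-reflexive (sym (concatMap-++ toList LF H))))
          ; mixed = All.++⁺ (All.++⁺ mixedL (All.tabulate⁺ λ b → zero , λ eq →
                      punchInᵢ≢i d b (trans (sym (monoF b zero)) eq)))
                      (All.map (λ { {_ ∷ _} ≢d → zero , ≢d }) heads)
          ; forcing = λ b d≢b → F (punchOut d≢b) , ∈-++⁺ˡ (∈-++⁺ʳ L (∈-tabulate⁺ (punchOut d≢b))) ,
                      λ i → trans (monoF _ i) (punchIn-punchOut d≢b)
          } , ∈-++⁺ˡ ∘ ∈-++⁺ˡ

      completeForced : Σ (Arrangement e c d) λ A → ∀ {g} → g ∈ L → g ∈ groups A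
      completeForced = assemble (filling (_∣_.quotient e∣rest) (_∣_.equality e∣rest))

    complete : ∀ {rest} → allFin n ↭ flat L ++ rest →
               Σ (Arrangement e c d) λ A → ∀ {g} → g ∈ L → g ∈ groups A
    complete {rest} p =
      let F , rest′ , p′ , allF = pickEach {e = suc e} (λ b x → c x ≟ punchIn d b) rest enough
      in completeForced F
           (↭-trans p (↭-trans (++⁺ˡ (flat L) p′) (↭-reflexive
             (trans (sym (++-assoc (flat L) (flat (tabulate F)) rest′))
                    (cong (_++ rest′) (sym (concatMap-++ toList L (tabulate F))))))))
           (λ b → all⇒mono c (F b) (allF b))
      where
        enough : ∀ b → k * suc e ≤ count (λ x → c x ≟ punchIn d b) rest
        enough b = count-drop (λ x → c x ≟ punchIn d b) (flat L) p
          (≤-trans (+-mono-≤ (≤-trans (≤-reflexive (length-flat L)) (*-monoˡ-≤ (suc e) |L|≤)) (m≤n+m (k * suc e) (suc e)))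
                   (≤-reflexive (sym t≡)))
          (large (punchIn d b))

record Killer {n k} e (c φ : Colouring n k) (d : Fin k) : Set where
  field
    L     : List (Vec (Fin n) (suc e))
    rest  : List (Fin n)
    split : allFin n ↭ flat L ++ rest
    short : length L ≤ k
    mixed : All (Mixed c d) L
    kills : ∀ b → ∃ λ g → g ∈ L × Mono φ b g

-- The group of colour φ u contains both u and v, so it is mixed for every d; the heads of the
-- other k groups miss some colour d.
module _ {n k e} (c φ : Colouring n (suc k)) (large : ∀ a → suc k * (2 + e) ≤ classSize φ a)
         (u v : Fin n) (φu≡φv : φ u ≡ φ v) (cu≢cv : c u ≢ c v) where

  private
    module _ (h : Vec (Fin n) e) {rest} (F : Fin k → Vec (Fin n) (2 + e))
             (p : allFin n ↭ (u ∷ v ∷ toList h) ++ flat (tabulate F) ++ rest)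
             (mono-h : Mono φ (φ u) h) (mono-F : ∀ b → Mono φ (punchIn (φ u) b) (F b)) where

      mixed-uv : ∀ d → Mixed c d (u ∷ v ∷ h)
      mixed-uv d with c u ≟ d
      ... | yes cu≡d = suc zero , λ cv≡d → cu≢cv (trans cu≡d (sym cv≡d))
      ... | no  cu≢d = zero , cu≢d

      kills : ∀ b → ∃ λ g → g ∈ (u ∷ v ∷ h) ∷ tabulate F × Mono φ b g
      kills b with φ u ≟ b
      ... | yes refl = _ , here refl , λ { zero → refl ; (suc zero) → sym φu≡φv ; (suc (suc i)) → mono-h i }
      ... | no  φu≢b = F (punchOut φu≢b) , there (∈-tabulate⁺ (punchOut φu≢b)) ,
                       λ i → trans (mono-F _ i) (punchIn-punchOut φu≢b)

      assemble : ∃ (Killer (suc e) c φ)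
      assemble with d , ≢d ← missed (λ b → c (Vec.lookup (F b) zero)) = d , record
        { L = (u ∷ v ∷ h) ∷ tabulate F
        ; rest = rest
        ; split = ↭-trans p (↭-reflexive (sym (++-assoc (u ∷ v ∷ toList h) (flat (tabulate F)) rest)))
        ; short = ≤-reflexive (cong suc (length-tabulate F))
        ; mixed = mixed-uv d ∷ All.tabulate⁺ (λ b → zero , ≢d b)
        ; kills = kills
        }

    completeClasses : (h : Vec (Fin n) e) {zs : List (Fin n)} → allFin n ↭ (u ∷ v ∷ toList h) ++ zs →
                      Mono φ (φ u) h → ∃ (Killer (suc e) c φ)
    completeClasses h {zs} p mono-h
      with F , rest , zs↭ , allF ← pickEach {e = 2 + e} (λ b x → φ x ≟ punchIn (φ u) b) zs
             (λ b → count-drop (λ x → φ x ≟ punchIn (φ u) b) (u ∷ v ∷ toList h) p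
               (≤-reflexive (cong (λ l → 2 + l + k * (2 + e)) (length-toList h))) (large (punchIn (φ u) b)))
      = assemble h F (↭-trans p (++⁺ˡ (u ∷ v ∷ toList h) zs↭)) mono-h (λ b → all⇒mono φ (F b) (allF b))

    extract : ∀ {xs} → v ∈ u ∷ xs → ∃ λ ys → u ∷ xs ↭ u ∷ v ∷ ys
    extract (here refl) = contradiction refl cu≢cv
    extract (there v∈) with ys , p ← ∈⇒↭ v∈ = ys , prep u p

    completeClass : ∀ {ys} → allFin n ↭ u ∷ v ∷ ys → ∃ (Killer (suc e) c φ)
    completeClass {ys} p
      with h , zs , ys↭ , all ← pick (λ x → φ x ≟ φ u) e ys
             (count-drop (λ x → φ x ≟ φ u) (u ∷ v ∷ []) p (m≤m+n (2 + e) (k * (2 + e))) (large (φ u)))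
      = completeClasses h (↭-trans p (prep u (prep v ys↭))) (all⇒mono φ h all)

  killer : ∃ (Killer (suc e) c φ)
  killer
    with xs , p ← ∈⇒↭ (∈-allFin u)
    with ys , r ← extract (∈-resp-↭ p (∈-allFin v)) = completeClass (↭-trans p r)

module Designs {n k e q t} (c : Colouring n (suc k)) (n≡ : n ≡ q * suc (suc e))
               (t≡ : t ≡ suc k * suc (suc e) + suc k * suc (suc e))
               (room : ∀ d → q + t ≤ tally (¬? ∘ (_≟ d)) c) (large : ∀ b → t ≤ classSize c b) where

  open Arranging c n≡ t≡ room large

  Recolours : Colouring n (suc k) → Set
  Recolours φ = Σ (Permutation′ (suc k)) λ π → ∀ x → φ x ≡ π ⟨$⟩ʳ c x

  Killed : Colouring n (suc k) → (∀ d → Arrangement (suc e) c d) → Set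
  Killed φ A = ∃ λ d → ∀ b → ∃ λ g → g ∈ groups (A d) × Mono φ b g

  0<t : 0 < t
  0<t = ≤-trans (s≤s z≤n) (≤-reflexive (sym t≡))

  default : ∀ d → Arrangement (suc e) c d
  default d = proj₁ (complete d [] z≤n [] {allFin n} ↭-refl)

  module Killing {φ : Colouring n (suc k)} {d : Fin (suc k)} (κ : Killer (suc e) c φ d) where

    killing : Σ (Arrangement (suc e) c d) λ A → ∀ {g} → g ∈ Killer.L κ → g ∈ groups A
    killing = complete d (Killer.L κ) (Killer.short κ) (Killer.mixed κ) (Killer.split κ)

    choose : ∀ {d′} → Dec (d ≡ d′) → Arrangement (suc e) c d′
    choose      (yes refl) = proj₁ killing
    choose {d′} (no _)     = default d′

    kills-chosen : (d≟d : Dec (d ≡ d)) → ∀ b → ∃ λ g → g ∈ groups (choose d≟d) × Mono φ b g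
    kills-chosen (yes refl) b = let g , g∈ , mono = Killer.kills κ b in g , proj₂ killing g∈ , mono
    kills-chosen (no  d≢d)  b = contradiction refl d≢d

  Design : Colouring n (suc k) → Set
  Design φ = Σ (∀ d → Arrangement (suc e) c d) λ A → (∀ a → t ≤ classSize φ a) → Recolours φ ⊎ Killed φ A

  kill : (φ : Colouring n (suc k)) → ∃ (Killer (suc e) c φ) → Design φ
  kill φ (d , κ) = (λ d′ → choose (d ≟ d′)) , λ _ → inj₂ (d , kills-chosen (d ≟ d))
    where open Killing κ

  design : (φ : Colouring n (suc k)) → Design φ
  design φ = decide (all? (λ a → t ≤? classSize φ a)) (any? (λ u → any? (λ v → (φ u ≟ φ v) ×-dec ¬? (c u ≟ c v))))
    where
      decide : Dec (∀ a → t ≤ classSize φ a) → Dec (∃ λ u → ∃ λ v → φ u ≡ φ v × c u ≢ c v) → Design φ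
      decide (no ¬large)  _         = default , λ largeφ → contradiction largeφ ¬large
      decide (yes largeφ) (no ¬bad) = default , λ _ → inj₁ (recolouring c φ
        (λ a → occurs c a (≤-trans 0<t (large a))) (λ a → occurs φ a (≤-trans 0<t (largeφ a)))
        (λ u v φu≡φv → decidable-stable (c u ≟ c v) (λ cu≢cv → ¬bad (u , v , φu≡φv , cu≢cv))))
      decide (yes largeφ) (yes (u , v , φu≡φv , cu≢cv)) =
        kill φ (killer c φ (λ a → ≤-trans (m≤m+n _ _) (≤-trans (≤-reflexive (sym t≡)) (largeφ a))) u v φu≡φv cu≢cv)

↑-elim : ∀ l {n} (P : Fin (l + n) → Set) → (∀ x → P (x ↑ˡ n)) → (∀ x → P (l ↑ʳ x)) → ∀ x → P x
↑-elim l {n} P Pˡ Pʳ x = subst P (join-splitAt l n x) (cases (splitAt l x))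
  where
    cases : ∀ s → P (join l n s)
    cases (inj₁ x) = Pˡ x
    cases (inj₂ x) = Pʳ x

module Final {k e n₀} (3≤k : 3 ≤ suc k) (3≤e : 3 ≤ suc (suc e)) (2e∣n₀ : 2 * suc (suc e) ∣ n₀)
         (S : StarSystem n₀ (suc (suc e))) (¬k : ¬ Colourable S k)
         (c₀ : Colouring n₀ (suc k)) (c₀-proper : Proper S c₀) (c₀-equitable : StronglyEquitable c₀) where

  copiesOf : ∀ t → Copies 3≤k 3≤e 2e∣n₀ S ¬k c₀ c₀-proper c₀-equitable t
  copiesOf = copies 3≤k 3≤e 2e∣n₀ S ¬k c₀ c₀-proper c₀-equitable

  module FromCopies {t} (t≡ : t ≡ suc k * suc (suc e) + suc k * suc (suc e))
    (X-copies : Copies 3≤k 3≤e 2e∣n₀ S ¬k c₀ c₀-proper c₀-equitable t)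
    (Y-copies : Copies 3≤k 3≤e 2e∣n₀ S ¬k c₀ c₀-proper c₀-equitable (suc k ^ Copies.order X-copies)) where

    module X = Copies X-copies
    module Y = Copies Y-copies
    open Designs X.colouring X.order≡ t≡ X.room (X.large X.colouring X.proper)

    arrangement : ∀ j d → Arrangement (suc e) X.colouring d
    arrangement j = proj₁ (design (finToFun j))

    arrangementAt : (y : Fin Y.order) → Arrangement (suc e) X.colouring (Y.colouring y)
    arrangementAt y = arrangement (Y.copy y) (Y.colouring y)

    grouped : ∀ y → _
    grouped y = grouping {q = X.q} (groups (arrangementAt y)) (perm (arrangementAt y)) X.order≡

    β : Fin Y.order → (Fin X.q × Fin (2 + e)) ↔ Fin X.order
    β y = proj₁ (grouped y)

    open Join Y.system X.system β using (joined; proper⁻ˡ; proper⁻ʳ; proper⁻ˣ)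

    c : Colouring (Y.order + X.order) (suc k)
    c = Y.colouring ∣∣ X.colouring

    mixed-β : ∀ y j → ∃ λ i → X.colouring (to (β y) (j , i)) ≢ Y.colouring y
    mixed-β y j =
      let g , g∈ , at = proj₁ (proj₂ (grouped y)) j
          i , ≢c = All.lookup (mixed (arrangementAt y)) g∈
      in i , λ eq → ≢c (trans (cong X.colouring (sym (at i))) eq)

    c-proper : Proper joined c
    c-proper = joinedColouring-proper Y.system X.system β Y.colouring X.colouring Y.proper X.proper mixed-β

    c-equitable : StronglyEquitable c
    c-equitable a b = trans (tally-∣∣ (_≟ a) Y.colouring X.colouring)
      (trans (cong₂ _+_ (Y.equitable a b) (X.equitable a b)) (sym (tally-∣∣ (_≟ b) Y.colouring X.colouring)))

    module Rigid (ψ : Colouring (Y.order + X.order) (suc k)) (ψ-proper : Proper joined ψ) where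

      ψX : Colouring X.order (suc k)
      ψX = ψ ∘ (Y.order ↑ʳ_)

      code : Fin (suc k ^ X.order)
      code = funToFin ψX

      φ : Colouring X.order (suc k)
      φ = finToFun code

      φ≗ψX : φ ≗ ψX
      φ≗ψX = finToFun-funToFin ψX

      φ-large : ∀ a → t ≤ classSize φ a
      φ-large = X.large φ (proper-cong X.system (sym ∘ φ≗ψX) (proper⁻ʳ ψ ψ-proper))

      avoids : ∀ y {g b} → g ∈ groups (arrangementAt y) → Mono φ b g → ψ (y ↑ˡ X.order) ≢ b
      avoids y g∈ mono eq =
        let j , at = proj₂ (proj₂ (grouped y)) g∈
        in proper⁻ˣ ψ ψ-proper y j λ i →
             trans (cong ψX (at i)) (trans (sym (φ≗ψX _)) (trans (mono i) (sym eq)))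

      ¬killed : ∀ {j d} y → Y.copy y ≡ j → Y.colouring y ≡ d →
                ¬ (∀ b → ∃ λ g → g ∈ groups (arrangement j d) × Mono φ b g)
      ¬killed y refl refl kills = let g , g∈ , mono = kills (ψ (y ↑ˡ X.order)) in avoids y g∈ mono refl

      recolours : (Recolours φ ⊎ Killed φ (arrangement code)) → Recolours φ
      recolours (inj₁ r)           = r
      recolours (inj₂ (d , kills)) = let y , eq , eq′ = Y.copy-onto code d in contradiction kills (¬killed y eq eq′)

      extends : Recolours φ → Σ (Permutation′ (suc k)) λ π → ∀ x → ψ x ≡ π ⟨$⟩ʳ c x
      extends (π , φ≡) = π , ↑-elim Y.order _
        (λ y → trans (forced y) (cong (π ⟨$⟩ʳ_) (sym (∣∣-ˡ Y.colouring X.colouring y))))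
        (λ x → trans (sym (φ≗ψX x)) (trans (φ≡ x) (cong (π ⟨$⟩ʳ_) (sym (∣∣-ʳ Y.colouring X.colouring x)))))
        where
          forced : ∀ y → ψ (y ↑ˡ X.order) ≡ π ⟨$⟩ʳ Y.colouring y
          forced y with Y.colouring y ≟ π ⟨$⟩ˡ ψ (y ↑ˡ X.order)
          ... | yes eq = trans (sym (inverseʳ π)) (cong (π ⟨$⟩ʳ_) (sym eq))
          ... | no  ≢b =
            let g , g∈ , mono = forcing (arrangementAt y) _ ≢b
            in contradiction (sym (inverseʳ π)) (avoids y g∈ λ i → trans (φ≡ _) (cong (π ⟨$⟩ʳ_) (mono i)))

      rigid : Σ (Permutation′ (suc k)) λ π → ∀ x → ψ x ≡ π ⟨$⟩ʳ c x
      rigid = extends (recolours (proj₂ (design φ) φ-large))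

    ¬colourable : ¬ Colourable joined k
    ¬colourable (ψ , ψ-proper) =
      let x , eq = occurs ψ′ zero (≤-trans 0<t (X.large ψ′ (λ j mono → proper⁻ʳ ψ ψ-proper j (suc-injective ∘ mono)) zero))
      in contradiction eq λ ()
      where
        ψ′ : Colouring X.order (suc k)
        ψ′ = suc ∘ ψ ∘ (Y.order ↑ʳ_)

    unique : ∀ (c₁ c₂ : Colouring (Y.order + X.order) (suc k)) → Proper joined c₁ → Proper joined c₂ →
             Σ (Permutation′ (suc k)) λ π → ∀ x → c₂ x ≡ π ⟨$⟩ʳ c₁ x
    unique c₁ c₂ p₁ p₂ =
      let π₁ , eq₁ = Rigid.rigid c₁ p₁
          π₂ , eq₂ = Rigid.rigid c₂ p₂
      in flip π₁ ∘ₚ π₂ , λ x →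
           trans (eq₂ x) (cong (π₂ ⟨$⟩ʳ_) (trans (sym (inverseˡ π₁)) (cong (π₁ ⟨$⟩ˡ_) (sym (eq₁ x)))))

    result : Σ ℕ λ n → (2 * suc (suc e) ∣ n) × Σ (StarSystem n (suc (suc e))) λ T → SEUniquelyChromatic T (suc k)
    result = Y.order + X.order , ∣m∣n⇒∣m+n Y.2e∣order X.2e∣order , joined ,
      ((c , c-proper) , ¬colourable) , ((c , c-proper) , unique) , (c , c-proper , c-equitable)

theorem4p4 : (k e : ℕ) → 3 ≤ k → 3 ≤ e →
    (Σ ℕ λ n₀ → (2 * e ∣ n₀) × Σ (StarSystem n₀ e) λ S → SEChromatic S k) →
    Σ ℕ λ n → (2 * e ∣ n) × Σ (StarSystem n e) λ S → SEUniquelyChromatic S k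
theorem4p4 k (suc zero) _ (s≤s ())
theorem4p4 (suc k) (suc (suc e)) 3≤k 3≤e (n₀ , 2e∣n₀ , S , (_ , ¬k) , c₀ , c₀-proper , c₀-equitable) =
  FromCopies.result refl (copiesOf t) (copiesOf (suc k ^ Copies.order (copiesOf t)))
  where
    open Final 3≤k 3≤e 2e∣n₀ S ¬k c₀ c₀-proper c₀-equitable
    t = suc k * suc (suc e) + suc k * suc (suc e)
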